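{- Let $s$ be a non-empty string of length $n$ over a finite alphabet $\Sigma$, and let $\sigma$ be the number of distinct characters occurring in $s$. Then $\mathit{PS}(s) < \sigma n$, where $\mathit{PS}(s)$ is the number of non-equivalent parameterized squares occurring in $s$.
   Context: Two strings $x,y$ of equal length $k$ over $\Sigma$ are parameterized equivalent, written $x \approx y$, if there is a bijection $f:\Sigma\to\Sigma$ with $f(x[i]) = y[i]$ for all $1 \le i \le k$. A string $w$ is a parameterized square if $w = xy$ for strings $x,y$ with $x \approx y$ (in particular every ordinary square $xx$ is a parameterized square). Let $\mathsf{PS}(s)$ be the set of all parameterized squares that are substrings of $s$, and let $\mathit{PS}(s)$ be the number of equivalence classes of $\mathsf{PS}(s)$ under $\approx$. -}

module Defs where

open import Data.Nat using (ℕ)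
open import Data.Fin using (Fin)
open import Data.Fin.Properties using (_≟_)
open import Data.List using (List; []; _∷_; _++_; map; length; deduplicate)
open import Data.Product using (Σ; ∃; ∃-syntax; _×_)
open import Function.Bundles using (Bijection)
open import Relation.Binary.PropositionalEquality using (_≡_)
open import Relation.Nullary using (¬_)

Str : ℕ → Set
Str k = List (Fin k)

-- Parameterized equivalence: a bijection f : Σ → Σ with f (x[i]) = y[i] for all i
-- (equal length follows from map f x ≡ y).
_≈ₚ_ : {k : ℕ} → Str k → Str k → Set
_≈ₚ_ {k} x y = Σ (Bijection (≡-setoid-Fin k) (≡-setoid-Fin k)) λ f → map (Bijection.to f) x ≡ y
  where
  open import Relation.Binary.PropositionalEquality using (setoid)
  ≡-setoid-Fin : ℕ → _
  ≡-setoid-Fin k = setoid (Fin k)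

IsPSquare : {k : ℕ} → Str k → Set
IsPSquare w = ∃[ x ] ∃[ y ] (¬ x ≡ [] × w ≡ x ++ y × x ≈ₚ y)

IsSubstring : {k : ℕ} → Str k → Str k → Set
IsSubstring w s = ∃[ u ] ∃[ v ] (u ++ w ++ v ≡ s)

σ : {k : ℕ} → Str k → ℕ
σ s = length (deduplicate _≟_ s)

{-# OPTIONS --safe #-}
module Submission where

-- Count each parameterized square at its last occurrence, up to equivalence. The last letter of
-- the string starts no square, so it suffices that at most K = σ squares are counted at any
-- position; suppose there were K + 1, with half-lengths m₀ < … < m_K and renamings f₀, …, f_K.
-- If m_K ≥ 2m₀, the shortest square recurs at distance m_K. Otherwise let a be the smallest
-- difference m_{j+1} − m_j; since there are K differences and they sum to less than m₀, the
-- first m₀ letters advance by a permutation p in steps of a, and the copies of this prefix at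
-- m₀, …, m_K overlap in at least (K − 1)a letters. Conjugate permutations of K letters that
-- agree along K − 1 letters of an orbit agree on the whole orbit, so all those copies follow a
-- single permutation q. Comparing the last two squares extends the p-run up to m_{K−1}; it then
-- overlaps the q-run so much that p continues beyond 2m₀ + a, and the shortest square recurs at
-- distance a.

open import Defs
open import Data.Bool using (true; false)
open import Data.Nat
open import Data.Nat.Properties
open import Data.Nat.DivMod using (_%_; _/_; m≡m%n+[m/n]*n; m%n<n)
open import Data.Nat.GeneralisedArithmetic using (fold; fold-+)
open import Data.Nat.Induction using (<-rec)
open import Data.Nat.Tactic.RingSolver using (solve-∀)
open import Data.Fin as F using (Fin; toℕ)
import Data.Fin.Properties as F
open import Data.Fin.Permutation as Perm using (Permutation′; _⟨$⟩ʳ_; _⟨$⟩ˡ_; _∘ₚ_)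
import Data.Fin.Permutation.Components as PC
open import Data.List using (List; []; _∷_; _++_; map; length; filter; lookup; deduplicate)
open import Data.List.Properties using (length-++; length-map)
open import Data.List.Relation.Unary.All as All using (All; []; _∷_)
import Data.List.Relation.Unary.All.Properties as All
open import Data.List.Relation.Unary.AllPairs as AllPairs using (AllPairs; []; _∷_)
import Data.List.Relation.Unary.AllPairs.Properties as AllPairs
open import Data.List.Relation.Unary.Any as Any using (here)
open import Data.List.Relation.Unary.Any.Properties using (lookup-index)
open import Data.List.Relation.Unary.Sorted.TotalOrder.Properties using (Sorted⇒AllPairs)
open import Data.List.Membership.Propositional using (_∈_)
open import Data.List.Membership.Propositional.Properties using (∈-deduplicate⁺)
import Data.List.Membership.DecPropositional as DecMembership
open import Data.List.Sort ≤-decTotalOrder using (sort; sort-↭; sort-↗)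
open import Data.List.Relation.Binary.Permutation.Propositional using (↭-sym; ↭⇒↭ₛ)
open import Data.List.Relation.Binary.Permutation.Propositional.Properties using (All-resp-↭; ↭-length)
import Data.List.Relation.Binary.Permutation.Setoid.Properties as PermSetoid
open import Data.Product using (∃; ∃₂; _×_; _,_; proj₁; proj₂)
open import Data.Sum using (inj₁; inj₂)
open import Relation.Binary.PropositionalEquality
open import Relation.Nullary
open import Relation.Nullary.Decidable using (map′; _×-dec_; _→-dec_; dec-true; dec-false; ¬?)
open import Relation.Unary using (Decidable)
open import Function.Base using (_∘_; case_of_; id)
open import Function.Bundles using (Bijection)
open import Function.Definitions using (Injective)
open import Function.Properties.Inverse using (Inverse⇒Bijection)

-- Orbits of permutations of a finite alphabet.

module _ {A : Set} {p : A → A} where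

  fold-injective : Injective _≡_ _≡_ p → ∀ n {x y} → fold x p n ≡ fold y p n → x ≡ y
  fold-injective inj zero    eq = eq
  fold-injective inj (suc n) eq = fold-injective inj n (inj eq)

  fold-return : Injective _≡_ _≡_ p → ∀ {c i j} → i ≤ j →
    fold c p i ≡ fold c p j → fold c p (j ∸ i) ≡ c
  fold-return inj {c} {i} {j} i≤j eq = sym (fold-injective inj i (begin
    fold c p i                    ≡⟨ eq ⟩
    fold c p j                    ≡⟨ cong (fold c p) (m+[n∸m]≡n i≤j) ⟨
    fold c p (i + (j ∸ i))        ≡⟨ fold-+ c p i ⟩
    fold (fold c p (j ∸ i)) p i   ∎))
    where open ≡-Reasoning

  fold-period : ∀ {c l} → fold c p l ≡ c → ∀ k → fold c p (k * l) ≡ c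
  fold-period         eq zero    = refl
  fold-period {c} {l} eq (suc k) = begin
    fold c p (l + k * l)        ≡⟨ fold-+ c p l ⟩
    fold (fold c p (k * l)) p l ≡⟨ cong (λ x → fold x p l) (fold-period eq k) ⟩
    fold c p l                  ≡⟨ eq ⟩
    c                           ∎
    where open ≡-Reasoning

  fold-% : ∀ {c l} .{{_ : NonZero l}} → fold c p l ≡ c → ∀ n → fold c p n ≡ fold c p (n % l)
  fold-% {c} {l} eq n = begin
    fold c p n                              ≡⟨ cong (fold c p) (m≡m%n+[m/n]*n n l) ⟩
    fold c p (n % l + n / l * l)            ≡⟨ fold-+ c p (n % l) ⟩
    fold (fold c p (n / l * l)) p (n % l)   ≡⟨ cong (λ x → fold x p (n % l)) (fold-period eq (n / l)) ⟩
    fold c p (n % l)                        ∎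
    where open ≡-Reasoning

fold-conj : ∀ {A : Set} (p q φ : A → A) → (∀ x → φ (p x) ≡ q (φ x)) →
  ∀ x n → φ (fold x p n) ≡ fold (φ x) q n
fold-conj p q φ eq x zero    = refl
fold-conj p q φ eq x (suc n) = trans (eq _) (cong q (fold-conj p q φ eq x n))

common-period : ∀ {A : Set} {p q : A → A} {c l} → fold c p (suc l) ≡ c → fold c q (suc l) ≡ c →
  (∀ n → n ≤ l → fold c p n ≡ fold c q n) → ∀ n → fold c p n ≡ fold c q n
common-period {p = p} {q} {c} {l} eqp eqq agree n = begin
  fold c p n            ≡⟨ fold-% eqp n ⟩
  fold c p (n % suc l)  ≡⟨ agree _ (≤-pred (m%n<n n (suc l))) ⟩
  fold c q (n % suc l)  ≡⟨ fold-% eqq n ⟨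
  fold c q n            ∎
  where open ≡-Reasoning

module _ {K} {p : Fin K → Fin K} (inj : Injective _≡_ _≡_ p) (c : Fin K) where

  bounded-period : ∃ λ l → l < K × fold c p (suc l) ≡ c
  bounded-period with F.pigeonhole (n<1+n K) (fold c p ∘ toℕ)
  ... | i , j , i<j , eq with toℕ j ∸ toℕ i in e | fold-return inj (<⇒≤ i<j) eq
  ... | zero  | _  = contradiction i<j (≤⇒≯ (m∸n≡0⇒m≤n e))
  ... | suc l | eq′ = l , subst (_≤ K) e (≤-trans (m∸n≤m (toℕ j) (toℕ i)) (F.toℕ≤pred[n] j)) , eq′

  orbit-covers : (∀ l → suc l < K → fold c p (suc l) ≢ c) → ∀ y → ∃ λ n → n < K × fold c p n ≡ y
  orbit-covers noReturn y with F.pigeonhole (n<1+n K) orbit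
    where
    -- With `y` listed before the first `K` iterates two entries must collide; two iterates
    -- colliding would be an early return, so `y` is an iterate.
    orbit : Fin (suc K) → Fin K
    orbit F.zero    = y
    orbit (F.suc i) = fold c p (toℕ i)
  ... | F.zero  , F.suc j , _       , eq = toℕ j , F.toℕ<n j , sym eq
  ... | F.suc i , F.suc j , s≤s i<j , eq with toℕ j ∸ toℕ i in e | fold-return inj (<⇒≤ i<j) eq
  ...   | zero  | _   = contradiction i<j (≤⇒≯ (m∸n≡0⇒m≤n e))
  ...   | suc l | eq′ = contradiction eq′ (noReturn l (≤-<-trans (subst (_≤ toℕ j) e (m∸n≤m (toℕ j) (toℕ i))) (F.toℕ<n j)))

module _ {K} {p : Fin K → Fin K} (inj : Injective _≡_ _≡_ p) where

  -- Injectivity cancels the `n` steps. Below, this compares the return times of `c` and `φ c` once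
  -- both are known to lie on one `q`-cycle.
  orbit-period : ∀ {c} l n → fold (fold c p n) p l ≡ fold c p n → fold c p l ≡ c
  orbit-period {c} l n eq = subst (λ k → fold c p k ≡ c) (m+n∸n≡m l n)
    (fold-return inj (m≤n+m n l) (sym (trans (fold-+ c p l) eq)))

-- The two orbits could only differ in their last letter, one having length N + 1 and the
-- other length N + 2; the latter would then be the whole alphabet, but conjugate
-- permutations have the same cycle type.
conjugate-orbits-agree : ∀ {N} {p q φ : Fin (2 + N) → Fin (2 + N)} →
  Injective _≡_ _≡_ p → Injective _≡_ _≡_ q → Injective _≡_ _≡_ φ →
  (∀ x → φ (p x) ≡ q (φ x)) → ∀ c →
  (∀ n → n ≤ N → fold c p n ≡ fold c q n) →
  ∀ n → fold c p n ≡ fold c q n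
conjugate-orbits-agree {N} {p} {q} {φ} injp injq injφ conj c agree
  with anyUpTo? (λ l → fold c p (suc l) F.≟ c) N
... | yes (l , l<N , eq) =
  -- Both orbits close up within the range where they agree.
  common-period eq (trans (sym (agree (suc l) l<N)) eq) (λ n n≤l → agree n (≤-trans n≤l (<⇒≤ l<N)))
... | no noReturn with fold c p (suc N) F.≟ c | fold c q (suc N) F.≟ c
...   | yes eqp | yes eqq = common-period eqp eqq agree
-- The `q`-cycle of `c` is then the whole alphabet and contains `φ c`, which inherits the return
-- time `suc N` from `p` by conjugacy.
...   | yes eqp | no neqq =
  let n , _ , eq = orbit-covers injq c noReturn-q (φ c)
  in contradiction
       (orbit-period injq (suc N) n (subst (λ y → fold y q (suc N) ≡ y) (sym eq)
         (trans (sym (fold-conj p q φ conj c (suc N))) (cong φ eqp))))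
       neqq
  where
  noReturn-q : ∀ l → suc l < 2 + N → fold c q (suc l) ≢ c
  noReturn-q l (s≤s (s≤s l≤N)) with m≤n⇒m<n∨m≡n l≤N
  ... | inj₁ l<N  = λ eq → noReturn (l , l<N , trans (agree (suc l) l<N) eq)
  ... | inj₂ refl = neqq
...   | no neqp | eqq? = same eqq?
  where
  noReturn-p : ∀ l → suc l < 2 + N → fold c p (suc l) ≢ c
  noReturn-p l (s≤s (s≤s l≤N)) with m≤n⇒m<n∨m≡n l≤N
  ... | inj₁ l<N  = λ eq → noReturn (l , l<N , eq)
  ... | inj₂ refl = neqp
  noReturn-φ : ∀ l → suc l < 2 + N → fold (φ c) q (suc l) ≢ φ c
  noReturn-φ l l< eq = noReturn-p l l< (injφ (trans (fold-conj p q φ conj c (suc l)) eq))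
  same : Dec (fold c q (suc N) ≡ c) → ∀ n → fold c p n ≡ fold c q n
  -- The orbit of `c` under `p` is full, so that of `φ c` under `q` is full too and contains `c`,
  -- which cannot return early.
  same (yes eqq) =
    let n , _ , eq = orbit-covers injq (φ c) noReturn-φ c
    in contradiction
         (orbit-period injq (suc N) n (subst (λ y → fold y q (suc N) ≡ y) (sym eq) eqq))
         (noReturn-φ N ≤-refl)
  same (no neqq) = common-period (full-period injp noReturn-p) (full-period injq noReturn-q) agree′
    where
    noReturn-q : ∀ l → suc l < 2 + N → fold c q (suc l) ≢ c
    noReturn-q l (s≤s (s≤s l≤N)) with m≤n⇒m<n∨m≡n l≤N
    ... | inj₁ l<N  = λ eq → noReturn (l , l<N , trans (agree (suc l) l<N) eq)
    ... | inj₂ refl = neqq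
    full-period : ∀ {r : Fin (2 + N) → Fin (2 + N)} → Injective _≡_ _≡_ r →
      (∀ l → suc l < 2 + N → fold c r (suc l) ≢ c) → fold c r (2 + N) ≡ c
    full-period injr noReturn-r with bounded-period injr c
    ... | l , s≤s l≤ , eq with m≤n⇒m<n∨m≡n l≤
    ...   | inj₁ l<   = contradiction eq (noReturn-r l (s≤s l<))
    ...   | inj₂ refl = eq
    -- The `p`-orbit reaches the letter `fold c q (suc N)`; at a step `n ≤ N` that letter would also
    -- be `fold c q n`, an early return of `q`.
    last : fold c p (suc N) ≡ fold c q (suc N)
    last with orbit-covers injp c noReturn-p (fold c q (suc N))
    ... | n , s≤s n≤ , eq with m≤n⇒m<n∨m≡n n≤
    ...   | inj₂ refl = eq
    ...   | inj₁ (s≤s n≤N) = contradiction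
            (subst (λ k → fold c q k ≡ c) (+-∸-assoc 1 n≤N)
              (fold-return injq (m≤n⇒m≤1+n n≤N) (trans (sym (agree n n≤N)) eq)))
            (noReturn-q (N ∸ n) (s≤s (s≤s (m∸n≤m N n))))
    agree′ : ∀ n → n ≤ suc N → fold c p n ≡ fold c q n
    agree′ n n≤ with m≤n⇒m<n∨m≡n n≤
    ... | inj₁ (s≤s n≤N) = agree n n≤N
    ... | inj₂ refl = last

-- Arithmetic, and runs: periodicity up to a permutation.

x+[a+b]≡x+b+a : ∀ x a b → x + (a + b) ≡ x + b + a
x+[a+b]≡x+b+a = solve-∀

minimum-at : ∀ (d : ℕ → ℕ) n → ∃ λ i → i ≤ n × (∀ j → j ≤ n → d i ≤ d j)
minimum-at d zero    = 0 , z≤n , λ { zero z≤n → ≤-refl }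
minimum-at d (suc n) with minimum-at d n
... | i , i≤n , min with ≤-total (d i) (d (suc n))
...   | inj₁ di≤ = i , m≤n⇒m≤1+n i≤n , λ j j≤ → case m≤n⇒m<n∨m≡n j≤ of λ where
          (inj₁ (s≤s j≤n)) → min j j≤n
          (inj₂ refl)      → di≤
...   | inj₂ ≤di = suc n , ≤-refl , λ j j≤ → case m≤n⇒m<n∨m≡n j≤ of λ where
          (inj₁ (s≤s j≤n)) → ≤-trans ≤di (min j j≤n)
          (inj₂ refl)      → ≤-refl

residue : ∀ a .{{_ : NonZero a}} {s i} → s ≤ i →
  ∃₂ λ k n → k < a × i ≡ s + k + n * a
residue a {s} {i} s≤i = (i ∸ s) % a , (i ∸ s) / a , m%n<n (i ∸ s) a , (begin
  i                                          ≡⟨ m+[n∸m]≡n s≤i ⟨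
  s + (i ∸ s)                                ≡⟨ cong (s +_) (m≡m%n+[m/n]*n (i ∸ s) a) ⟩
  s + ((i ∸ s) % a + (i ∸ s) / a * a)        ≡⟨ +-assoc s _ _ ⟨
  s + (i ∸ s) % a + (i ∸ s) / a * a          ∎)
  where open ≡-Reasoning

-- With `p` the identity, this is ordinary period `a` on the positions from `s` to `e - 1`.
Run : ∀ {A : Set} → (ℕ → A) → ℕ → (A → A) → ℕ → ℕ → Set
Run z a p s e = ∀ t → s ≤ t → t + a < e → z (t + a) ≡ p (z t)

run-fold : ∀ {A : Set} {z : ℕ → A} {a p s e} → Run z a p s e →
  ∀ n {t} → s ≤ t → t + n * a < e → z (t + n * a) ≡ fold (z t) p n
run-fold {z = z}         run zero    {t} s≤t t<e = cong z (+-identityʳ t)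
run-fold {z = z} {a} {p} {e = e} run (suc n) {t} s≤t t<e = begin
  z (t + (a + n * a))      ≡⟨ cong z (x+[a+b]≡x+b+a t a (n * a)) ⟩
  z (t + n * a + a)        ≡⟨ run (t + n * a) (m≤n⇒m≤n+o (n * a) s≤t) (subst (_< e) (x+[a+b]≡x+b+a t a (n * a)) t<e) ⟩
  p (z (t + n * a))        ≡⟨ cong p (run-fold run n s≤t (≤-<-trans (+-monoʳ-≤ t (m≤n+m (n * a) a)) t<e)) ⟩
  p (fold (z t) p n)       ∎
  where open ≡-Reasoning

-- Only the indices j ≤ K of m, f and g are meaningful.
record PrefixSquares {K} (z : ℕ → Fin K) : Set where
  field
    m      : ℕ → ℕ
    f g    : ℕ → Fin K → Fin K
    fg     : ∀ j x → f j (g j x) ≡ x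
    gf     : ∀ j x → g j (f j x) ≡ x
    square : ∀ j → j ≤ K → ∀ i → i < m j → z (m j + i) ≡ f j (z i)
    mono   : ∀ j → j < K → m j < m (suc j)
    pos    : 0 < m 0

  f-injective : ∀ j → Injective _≡_ _≡_ (f j)
  f-injective j eq = trans (sym (gf j _)) (trans (cong (g j) eq) (gf j _))

  g-injective : ∀ j → Injective _≡_ _≡_ (g j)
  g-injective j eq = trans (sym (fg j _)) (trans (cong (f j) eq) (fg j _))

-- Squares whose half-lengths are all below twice the smallest.

module Overlapping {N} {z : ℕ → Fin (2 + N)} (S : PrefixSquares z)
  (overlapping : PrefixSquares.m S (2 + N) < PrefixSquares.m S 0 + PrefixSquares.m S 0) where

  open PrefixSquares S

  gap : ℕ → ℕ
  gap j = m (suc j) ∸ m j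

  private
    minimal = minimum-at gap (suc N)

  j₀ : ℕ
  j₀ = proj₁ minimal

  j₀< : j₀ < 2 + N
  j₀< = s≤s (proj₁ (proj₂ minimal))

  a : ℕ
  a = gap j₀

  0<a : 0 < a
  0<a = m<n⇒0<n∸m (mono j₀ j₀<)

  instance
    a-nonZero : NonZero a
    a-nonZero = >-nonZero 0<a

  gap-at : m j₀ + a ≡ m (suc j₀)
  gap-at = m+[n∸m]≡n (<⇒≤ (mono j₀ j₀<))

  step : ∀ j → j < 2 + N → m j + a ≤ m (suc j)
  step j j<@(s≤s j≤) = begin
    m j + a     ≤⟨ +-monoʳ-≤ (m j) (proj₂ (proj₂ minimal) j j≤) ⟩
    m j + gap j ≡⟨ m+[n∸m]≡n (<⇒≤ (mono j j<)) ⟩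
    m (suc j)   ∎
    where open ≤-Reasoning

  steps : ∀ d j → j + d ≤ 2 + N → m j + d * a ≤ m (j + d)
  steps zero    j _  = ≤-reflexive (trans (+-identityʳ (m j)) (cong m (sym (+-identityʳ j))))
  steps (suc d) j j+d< = begin
    m j + (a + d * a) ≡⟨ x+[a+b]≡x+b+a (m j) a (d * a) ⟩
    m j + d * a + a   ≤⟨ +-monoˡ-≤ a (steps d j (<⇒≤ j+d<′)) ⟩
    m (j + d) + a     ≤⟨ step (j + d) j+d<′ ⟩
    m (suc (j + d))   ≡⟨ cong m (+-suc j d) ⟨
    m (j + suc d)     ∎
    where
    open ≤-Reasoning
    j+d<′ : j + d < 2 + N
    j+d<′ = subst (_≤ 2 + N) (+-suc j d) j+d<

  m-mono : ∀ {i j} → i ≤ j → j ≤ 2 + N → m i ≤ m j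
  m-mono {i} {j} i≤j j≤ = begin
    m i                 ≤⟨ m≤m+n (m i) _ ⟩
    m i + (j ∸ i) * a   ≤⟨ steps (j ∸ i) i (subst (_≤ 2 + N) (sym (m+[n∸m]≡n i≤j)) j≤) ⟩
    m (i + (j ∸ i))     ≡⟨ cong m (m+[n∸m]≡n i≤j) ⟩
    m j                 ∎
    where open ≤-Reasoning

  -- All gaps together sum to less than `m 0`, and besides `gap j` there are `suc N` of them, each
  -- at least `a`. Hence the copies of the prefix at `m j` and `m (suc j)` overlap in more than
  -- `suc N * a` letters.
  wide : ∀ j → j < 2 + N → m (suc j) + suc N * a < m j + m 0
  wide j j<@(s≤s j≤) = +-cancelʳ-< (m 0) _ _ (begin-strict
    m (suc j) + suc N * a + m 0                      ≡⟨ cong (λ k → m (suc j) + k * a + m 0) (m+[n∸m]≡n j≤) ⟨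
    m (suc j) + (j + (suc N ∸ j)) * a + m 0          ≡⟨ regroup (m (suc j)) j (suc N ∸ j) a (m 0) ⟩
    (m 0 + j * a) + (m (suc j) + (suc N ∸ j) * a)    ≤⟨ +-mono-≤ (steps j 0 (<⇒≤ j<)) (steps (suc N ∸ j) (suc j) (≤-reflexive (cong suc (m+[n∸m]≡n j≤)))) ⟩
    m j + m (suc (j + (suc N ∸ j)))                  ≡⟨ cong (λ k → m j + m (suc k)) (m+[n∸m]≡n j≤) ⟩
    m j + m (2 + N)                                  <⟨ +-monoʳ-< (m j) overlapping ⟩
    m j + (m 0 + m 0)                                ≡⟨ +-assoc (m j) (m 0) (m 0) ⟨
    m j + m 0 + m 0                                  ∎)
    where
    open ≤-Reasoning
    regroup : ∀ x j d a y → x + (j + d) * a + y ≡ (y + j * a) + (x + d * a)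
    regroup = solve-∀

  a≤m₀ : a ≤ m 0
  a≤m₀ = +-cancelˡ-≤ (m 0) _ _ (begin
    m 0 + a               ≤⟨ +-monoʳ-≤ (m 0) (m≤m+n a (suc N * a)) ⟩
    m 0 + (2 + N) * a     ≤⟨ steps (2 + N) 0 ≤-refl ⟩
    m (2 + N)             ≤⟨ <⇒≤ overlapping ⟩
    m 0 + m 0             ∎)
    where open ≤-Reasoning

  p q : Fin (2 + N) → Fin (2 + N)
  p x = g j₀ (f (suc j₀) x)
  q x = f 0 (p (g 0 x))

  -- The step `p` as it appears in the copy of the prefix at `m j`; `q` is the case of `j = 0`.
  q-of : ℕ → Fin (2 + N) → Fin (2 + N)
  q-of j x = f j (p (g j x))

  p-injective : Injective _≡_ _≡_ p
  p-injective = f-injective (suc j₀) ∘ g-injective j₀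

  q-of-injective : ∀ j → Injective _≡_ _≡_ (q-of j)
  q-of-injective j = g-injective j ∘ p-injective ∘ f-injective j

  f-conj : ∀ j x → f j (p x) ≡ q-of j (f j x)
  f-conj j x = cong (f j ∘ p) (sym (gf j x))

  -- The letter at `m j₀ + i + a` is read twice: as offset `i + a` in the square `j₀`, and as offset
  -- `i` in the square `suc j₀`.
  p-run : Run z a p 0 (m 0)
  p-run i _ i+a< = begin
    z (i + a)                              ≡⟨ gf j₀ _ ⟨
    g j₀ (f j₀ (z (i + a)))                ≡⟨ cong (g j₀) (square j₀ (<⇒≤ j₀<) (i + a) (≤-trans i+a< (m-mono z≤n (<⇒≤ j₀<)))) ⟨
    g j₀ (z (m j₀ + (i + a)))              ≡⟨ cong (g j₀ ∘ z) (trans (x+[a+b]≡x+b+a (m j₀) i a) (cong (_+ i) gap-at)) ⟩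
    g j₀ (z (m (suc j₀) + i))              ≡⟨ cong (g j₀) (square (suc j₀) j₀< i (≤-trans (≤-<-trans (m≤m+n i a) i+a<) (m-mono z≤n j₀<))) ⟩
    p (z i)                                ∎
    where open ≡-Reasoning

  -- In other words, `q` and `q-of j` agree on the orbits through the first `a` letters of the copy
  -- at `m j`. As `n` is unbounded, this remains usable when the `p`-run grows beyond `m 0`.
  Transports : ℕ → Set
  Transports j = ∀ k n → k < a → fold (f j (z k)) q n ≡ f j (fold (z k) p n)

  -- Every letter of a `p`-run from 0 is an iterate of one of its first `a` letters.
  transports-commute : ∀ {j e} → Transports j → Run z a p 0 e →
    ∀ i → i < e → q (f j (z i)) ≡ f j (p (z i))
  transports-commute {j} {e} tr run i i<e with residue a {0} {i} z≤n
  ... | k , n , k<a , eq = begin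
    q (f j (z i))                ≡⟨ cong (q ∘ f j) zi ⟩
    q (f j (fold (z k) p n))     ≡⟨ cong q (tr k n k<a) ⟨
    q (fold (f j (z k)) q n)     ≡⟨ tr k (suc n) k<a ⟩
    f j (p (fold (z k) p n))     ≡⟨ cong (f j ∘ p) zi ⟨
    f j (p (z i))                ∎
    where
    open ≡-Reasoning
    zi : z i ≡ fold (z k) p n
    zi = trans (cong z eq) (run-fold run n z≤n (subst (_< e) eq i<e))

  image-run : ∀ {j e} → j ≤ 2 + N → Transports j → Run z a p 0 e → e ≤ m j →
    Run z a q (m j) (m j + e)
  image-run {j} {e} j≤ tr run e≤ t mj≤t t+a< = begin
    z (t + a)             ≡⟨ cong (λ t → z (t + a)) t≡ ⟩
    z (m j + i + a)       ≡⟨ cong z (+-assoc (m j) i a) ⟩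
    z (m j + (i + a))     ≡⟨ square j j≤ (i + a) (<-≤-trans i+a<e e≤) ⟩
    f j (z (i + a))       ≡⟨ cong (f j) (run i z≤n i+a<e) ⟩
    f j (p (z i))         ≡⟨ transports-commute tr run i i<e ⟨
    q (f j (z i))         ≡⟨ cong q (square j j≤ i (<-≤-trans i<e e≤)) ⟨
    q (z (m j + i))       ≡⟨ cong (q ∘ z) t≡ ⟨
    q (z t)               ∎
    where
    open ≡-Reasoning
    i = t ∸ m j
    t≡ : t ≡ m j + i
    t≡ = sym (m+[n∸m]≡n mj≤t)
    i+a<e : i + a < e
    i+a<e = +-cancelˡ-< (m j) _ _ (subst (_< m j + e) (trans (cong (_+ a) t≡) (+-assoc (m j) i a)) t+a<)
    i<e : i < e
    i<e = ≤-<-trans (m≤m+n i a) i+a<e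

  in-block : ∀ {k n} → k < a → n ≤ N → k + n * a < suc N * a
  in-block {k} {n} k<a n≤N = +-mono-<-≤ k<a (*-monoˡ-≤ a n≤N)

  -- Induction on `j`. In the overlap given by `wide`, the known `q`-run meets the next copy, which
  -- follows `q-of (suc j)`; so the two permutations agree along `suc N` letters of each orbit.
  -- Being conjugate, they agree on the whole orbits, and the `q`-run continues through that copy.
  q-run-upto : ∀ j → j ≤ 2 + N → Transports j × Run z a q (m 0) (m j + m 0)
  q-run-upto zero    j≤ = tr₀ , image-run z≤n tr₀ p-run ≤-refl
    where
    tr₀ : Transports 0
    tr₀ k n _ = sym (fold-conj p q (f 0) (f-conj 0) (z k) n)
  q-run-upto (suc j) j< with q-run-upto j (<⇒≤ j<)
  ... | trⱼ , runⱼ = tr , run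
    where
    φ : Fin (2 + N) → Fin (2 + N)
    φ x = f (suc j) (g 0 x)
    φ-conj : ∀ x → φ (q x) ≡ q-of (suc j) (φ x)
    φ-conj x = trans (cong (f (suc j)) (gf 0 _)) (f-conj (suc j) _)
    agree : ∀ k → k < a → ∀ n → n ≤ N →
      fold (f (suc j) (z k)) q n ≡ fold (f (suc j) (z k)) (q-of (suc j)) n
    agree k k<a n n≤N = begin
      fold (f (suc j) (z k)) q n             ≡⟨ cong (λ c → fold c q n) (square (suc j) j< k k<m) ⟨
      fold (z (m (suc j) + k)) q n           ≡⟨ run-fold runⱼ n (m≤n⇒m≤n+o k (m-mono z≤n j<)) in-overlap ⟨
      z (m (suc j) + k + n * a)              ≡⟨ cong z (+-assoc (m (suc j)) k (n * a)) ⟩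
      z (m (suc j) + (k + n * a))            ≡⟨ square (suc j) j< (k + n * a) (<-≤-trans k+na<m₀ (m-mono z≤n j<)) ⟩
      f (suc j) (z (k + n * a))              ≡⟨ cong (f (suc j)) (run-fold p-run n z≤n k+na<m₀) ⟩
      f (suc j) (fold (z k) p n)             ≡⟨ fold-conj p (q-of (suc j)) (f (suc j)) (f-conj (suc j)) (z k) n ⟩
      fold (f (suc j) (z k)) (q-of (suc j)) n ∎
      where
      open ≡-Reasoning
      in-overlap : m (suc j) + k + n * a < m j + m 0
      in-overlap = subst (_< m j + m 0) (sym (+-assoc (m (suc j)) k (n * a)))
        (<-trans (+-monoʳ-< (m (suc j)) (in-block k<a n≤N)) (wide j j<))
      k+na<m₀ : k + n * a < m 0
      k+na<m₀ = +-cancelˡ-< (m (suc j)) _ _ (<-≤-trans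
        (subst (_< m j + m 0) (+-assoc (m (suc j)) k (n * a)) in-overlap)
        (+-monoˡ-≤ (m 0) (<⇒≤ (mono j j<))))
      k<m : k < m (suc j)
      k<m = ≤-<-trans (m≤m+n k (n * a)) (<-≤-trans k+na<m₀ (m-mono z≤n j<))
    tr : Transports (suc j)
    tr k n k<a = trans
      (conjugate-orbits-agree (q-of-injective 0) (q-of-injective (suc j))
        (g-injective 0 ∘ f-injective (suc j)) φ-conj _ (agree k k<a) n)
      (sym (fold-conj p (q-of (suc j)) (f (suc j)) (f-conj (suc j)) (z k) n))
    run : Run z a q (m 0) (m (suc j) + m 0)
    run t m₀≤t t+a< with t + a <? m j + m 0
    ... | yes t+a<′ = runⱼ t m₀≤t t+a<′
    -- A step that ends beyond the old run starts inside the new copy, because the overlap has at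
    -- least `a` letters.
    ... | no  t+a≮ = image-run j< tr p-run (m-mono z≤n j<) t
      (+-cancelʳ-≤ a _ _ (begin
        m (suc j) + a           ≤⟨ +-monoʳ-≤ (m (suc j)) (m≤m+n a (N * a)) ⟩
        m (suc j) + suc N * a   ≤⟨ <⇒≤ (wide j j<) ⟩
        m j + m 0               ≤⟨ ≮⇒≥ t+a≮ ⟩
        t + a                   ∎)) t+a<
      where open ≤-Reasoning

  q-run : Run z a q (m 0) (m (2 + N) + m 0)
  q-run = proj₂ (q-run-upto (2 + N) ≤-refl)

  -- If the p-run broke inside the first halves of both of the last two squares, the q-run would
  -- break at the copies of that position in their second halves, which are distinct positions.
  p-run-extends : ∀ e → e ≤ m (suc N) → Run z a p 0 e
  p-run-extends = <-rec _ extend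
    where
    j = suc N
    tr-j : Transports j
    tr-j = proj₁ (q-run-upto j (n≤1+n _))
    extend : ∀ e → (∀ {e′} → e′ < e → e′ ≤ m j → Run z a p 0 e′) → e ≤ m j → Run z a p 0 e
    extend zero    rec e≤ i _ ()
    extend (suc e) rec e< i _ (s≤s i+a≤e) with m≤n⇒m<n∨m≡n i+a≤e
    ... | inj₁ i+a<e = rec ≤-refl (<⇒≤ e<) i z≤n i+a<e
    ... | inj₂ refl with i + a <? m 0
    ...   | yes i+a<m₀ = p-run i z≤n i+a<m₀
    -- The missing step is verified after applying `f j`, where it is a `q`-step in the second half
    -- of the square `j`.
    ...   | no  i+a≮m₀ = f-injective j (begin
      f j (z (i + a))      ≡⟨ square j (n≤1+n _) (i + a) e< ⟨
      z (m j + (i + a))    ≡⟨ cong z (+-assoc (m j) i a) ⟨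
      z (m j + i + a)      ≡⟨ q-step ⟩
      q (z (m j + i))      ≡⟨ cong q (square j (n≤1+n _) i (≤-<-trans (m≤m+n i a) e<)) ⟩
      q (f j (z i))        ≡⟨ transports-commute tr-j (rec ≤-refl (<⇒≤ e<)) i i<e ⟩
      f j (p (z i))        ∎)
      where
      open ≡-Reasoning
      i<e : i < i + a
      i<e = m<m+n i 0<a
      q-step : z (m j + i + a) ≡ q (z (m j + i))
      q-step with m j + i + a <? m (suc j) + m 0
      ... | yes lt = q-run (m j + i) (m≤n⇒m≤n+o i (m-mono z≤n (n≤1+n _))) lt
      -- Past the known `q`-run, the step lies in the second half of the last square. Its offset
      -- there is smaller than `i + a` because `m j < m (suc j)`, so the induction hypothesis covers
      -- it.
      ... | no  ge = image-run ≤-refl (proj₁ (q-run-upto (suc j) ≤-refl)) (rec ≤-refl (<⇒≤ e<))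
        (≤-trans (<⇒≤ e<) (m-mono (n≤1+n _) ≤-refl)) (m j + i)
        (+-cancelʳ-≤ a _ _ (≤-trans (+-monoʳ-≤ (m (suc j)) a≤m₀) (≮⇒≥ ge)))
        (subst (_< m (suc j) + (i + a)) (sym (+-assoc (m j) i a)) (+-monoˡ-< (i + a) (mono j ≤-refl)))

  first-gaps : m 0 + suc N * a ≤ m (suc N)
  first-gaps = steps (suc N) 0 (n≤1+n _)

  -- The extended `p`-run and the `q`-run share the `suc N * a` letters from `m 0` on, which is
  -- `suc N` letters of each orbit.
  p-q-agree : ∀ k n → k < a → fold (z (m 0 + k)) p n ≡ fold (z (m 0 + k)) q n
  p-q-agree k n k<a = conjugate-orbits-agree p-injective (q-of-injective 0) (f-injective 0)
    (f-conj 0) _ agree n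
    where
    agree : ∀ n → n ≤ N → fold (z (m 0 + k)) p n ≡ fold (z (m 0 + k)) q n
    agree n n≤N = trans
      (sym (run-fold (p-run-extends _ ≤-refl) n z≤n in-run))
      (run-fold q-run n (m≤m+n (m 0) k) (<-≤-trans in-run (≤-trans (m-mono (n≤1+n _) ≤-refl) (m≤m+n _ _))))
      where
      in-run : m 0 + k + n * a < m (suc N)
      in-run = <-≤-trans (subst (_< m 0 + suc N * a) (sym (+-assoc (m 0) k (n * a)))
        (+-monoʳ-< (m 0) (in-block k<a n≤N))) first-gaps

  m₀+a≤ : m 0 + a ≤ m (suc N)
  m₀+a≤ = ≤-trans (+-monoʳ-≤ (m 0) (m≤m+n a (N * a))) first-gaps

  -- In the first half the step belongs to the extended `p`-run; in the second half it is a `q`-step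
  -- on an orbit where `p` and `q` coincide.
  reoccurs : ∀ i → i < m 0 + m 0 → z (i + a) ≡ p (z i)
  reoccurs i i< with i <? m 0
  ... | yes i<m₀ = p-run-extends _ ≤-refl i z≤n (<-≤-trans (+-monoˡ-< a i<m₀) m₀+a≤)
  ... | no  i≮m₀ with residue a (≮⇒≥ i≮m₀)
  ...   | k , n , k<a , eq = begin
    z (i + a)                       ≡⟨ q-run i (≮⇒≥ i≮m₀) i+a< ⟩
    q (z i)                         ≡⟨ cong q zi ⟩
    fold (z (m 0 + k)) q (suc n)    ≡⟨ p-q-agree k (suc n) k<a ⟨
    p (fold (z (m 0 + k)) p n)      ≡⟨ cong p (p-q-agree k n k<a) ⟩
    p (fold (z (m 0 + k)) q n)      ≡⟨ cong p zi ⟨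
    p (z i)                         ∎
    where
    open ≡-Reasoning
    i+a< : i + a < m (2 + N) + m 0
    i+a< = <-≤-trans (+-monoˡ-< a i<) (subst (_≤ m (2 + N) + m 0) (swap (m 0) a)
      (+-monoˡ-≤ (m 0) (≤-trans m₀+a≤ (m-mono (n≤1+n _) ≤-refl))))
      where
      swap : ∀ x a → x + a + x ≡ x + x + a
      swap = solve-∀
    zi : z i ≡ fold (z (m 0 + k)) q n
    zi = trans (cong z eq) (run-fold q-run n (m≤m+n (m 0) k)
      (subst (_< m (2 + N) + m 0) eq (≤-<-trans (m≤m+n i a) i+a<)))

  fits : a + (m 0 + m 0) ≤ m (2 + N) + m (2 + N)
  fits = subst (_≤ m (2 + N) + m (2 + N)) (swap (m 0) a)
      (+-mono-≤ (≤-trans m₀+a≤ (m-mono (n≤1+n _) ≤-refl)) (m-mono z≤n ≤-refl))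
    where
    swap : ∀ x a → x + a + x ≡ a + (x + x)
    swap = solve-∀

-- Recurrence of the shortest square.

module _ {K} {z : ℕ → Fin K} (S : PrefixSquares z) where

  open PrefixSquares S

  -- The bound `m K + m K` keeps the recurrence inside the longest square, hence inside the string.
  FirstReoccurs : Set
  FirstReoccurs = ∃₂ λ a (p : Fin K → Fin K) → 0 < a × a + (m 0 + m 0) ≤ m K + m K ×
    Injective _≡_ _≡_ p × (∀ i → i < m 0 + m 0 → z (i + a) ≡ p (z i))

  -- The shortest square lies in the first half of the longest one, which the second half copies.
  first-reoccurs-disjoint : m 0 + m 0 ≤ m K → FirstReoccurs
  first-reoccurs-disjoint m₀≤ = m K , f K ,
    <-≤-trans pos (≤-trans (m≤m+n (m 0) (m 0)) m₀≤) ,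
    +-monoʳ-≤ (m K) m₀≤ ,
    f-injective K ,
    λ i i< → trans (cong z (+-comm i (m K))) (square K ≤-refl i (<-≤-trans i< m₀≤))

first-reoccurs : ∀ {K} {z : ℕ → Fin K} (S : PrefixSquares z) → FirstReoccurs S
first-reoccurs {zero} {z} S = contradiction (z 0) F.¬Fin0
-- Over a single letter every shift is a recurrence, and distance 1 fits since `m 0 < m 1`.
first-reoccurs {1} S = 1 , id , s≤s z≤n , +-mono-≤ (mono 0 ≤-refl) (<⇒≤ (mono 0 ≤-refl)) ,
  id , λ _ _ → unique _ _
  where
  open PrefixSquares S
  unique : ∀ (x y : Fin 1) → x ≡ y
  unique F.zero F.zero = refl
first-reoccurs {suc (suc N)} S with PrefixSquares.m S (2 + N) <? PrefixSquares.m S 0 + PrefixSquares.m S 0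
... | no  ¬overlapping = first-reoccurs-disjoint S (≮⇒≥ ¬overlapping)
... | yes overlapping  = a , p , 0<a , fits , p-injective , reoccurs
  where open Overlapping S overlapping

-- Equivalence of words given as functions on positions.

infix 4 _∼[_]_

-- Parameterized equivalence of words over possibly different alphabets: the letters at two
-- positions coincide in one word iff they do in the other.
record _∼[_]_ {A B : Set} (x : ℕ → A) (l : ℕ) (y : ℕ → B) : Set where
  constructor same-kernel
  field
    coincide : ∀ {i} → i < l → ∀ {j} → j < l → (x i ≡ x j → y i ≡ y j) × (y i ≡ y j → x i ≡ x j)

open _∼[_]_

module _ {A B : Set} {x : ℕ → A} {y : ℕ → B} where

  ∼-sym : ∀ {l} → x ∼[ l ] y → y ∼[ l ] x
  ∼-sym x∼y .coincide i< j< = proj₂ (x∼y .coincide i< j<) , proj₁ (x∼y .coincide i< j<)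

  ∼-trans : ∀ {C : Set} {w : ℕ → C} {l} → x ∼[ l ] y → y ∼[ l ] w → x ∼[ l ] w
  ∼-trans x∼y y∼w .coincide i< j< =
    proj₁ (y∼w .coincide i< j<) ∘ proj₁ (x∼y .coincide i< j<) ,
    proj₂ (x∼y .coincide i< j<) ∘ proj₂ (y∼w .coincide i< j<)

  ∼-prefix : ∀ {l l′} → l′ ≤ l → x ∼[ l ] y → x ∼[ l′ ] y
  ∼-prefix l′≤l x∼y .coincide i< j< = x∼y .coincide (<-≤-trans i< l′≤l) (<-≤-trans j< l′≤l)

  ∼-drop : ∀ {l} s k → s + k ≤ l → x ∼[ l ] y → (x ∘ (s +_)) ∼[ k ] (y ∘ (s +_))
  ∼-drop s k s+k≤l x∼y .coincide i< j< =
    x∼y .coincide (<-≤-trans (+-monoʳ-< s i<) s+k≤l) (<-≤-trans (+-monoʳ-< s j<) s+k≤l)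

  ∼-injective : ∀ {p : A → B} → Injective _≡_ _≡_ p → ∀ {l} → (∀ i → i < l → y i ≡ p (x i)) → x ∼[ l ] y
  ∼-injective {p} inj y≡px .coincide {i} i< {j} j< =
    (λ eq → trans (y≡px i i<) (trans (cong p eq) (sym (y≡px j j<)))) ,
    (λ eq → inj (trans (sym (y≡px i i<)) (trans eq (y≡px j j<))))

∼-dec : ∀ {K K′} (x : ℕ → Fin K) (y : ℕ → Fin K′) l → Dec (x ∼[ l ] y)
∼-dec x y l = map′ same-kernel coincide (allUpTo? (λ i → allUpTo? (λ j →
  ((x i F.≟ x j) →-dec (y i F.≟ y j)) ×-dec ((y i F.≟ y j) →-dec (x i F.≟ x j))) l) l)

transpose-fixes : ∀ {n} {i j k : Fin n} → k ≢ i → k ≢ j → PC.transpose i j k ≡ k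
transpose-fixes {i = i} {j} {k} k≢i k≢j
  rewrite dec-false (k F.≟ i) k≢i | dec-false (k F.≟ j) k≢j = refl

transpose-left : ∀ {n} (i j : Fin n) → PC.transpose i j i ≡ j
transpose-left i j rewrite dec-true (i F.≟ i) refl = refl

-- Built letter by letter: if `π` sends `x l` to a wrong letter, it is followed by the transposition
-- of that letter with `y l`. Earlier values are neither of these two letters, by the kernel
-- condition, and stay put.
∼⇒permutation : ∀ {k} l {x y : ℕ → Fin k} → x ∼[ l ] y →
  ∃ λ (π : Permutation′ k) → ∀ i → i < l → y i ≡ π ⟨$⟩ʳ x i
∼⇒permutation zero    x∼y = Perm.id , λ i ()
∼⇒permutation (suc l) {x} {y} x∼y with ∼⇒permutation l (∼-prefix (n≤1+n l) x∼y)
... | π , eq with π ⟨$⟩ʳ x l F.≟ y l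
...   | yes πxl≡yl = π , λ i i≤l → case m≤n⇒m<n∨m≡n i≤l of λ where
          (inj₁ (s≤s i<l)) → eq i i<l
          (inj₂ refl)      → sym πxl≡yl
...   | no  πxl≢yl = π ∘ₚ Perm.transpose (π ⟨$⟩ʳ x l) (y l) , λ i i≤l → case m≤n⇒m<n∨m≡n i≤l of λ where
          (inj₁ (s≤s i<l)) →
            let coincideₗ = x∼y .coincide (m<n⇒m<1+n i<l) ≤-refl
                yi≢yl : y i ≢ y l
                yi≢yl yi≡yl = πxl≢yl (trans (cong (π ⟨$⟩ʳ_) (sym (proj₂ coincideₗ yi≡yl)))
                                            (trans (sym (eq i i<l)) yi≡yl))
            in trans (eq i i<l) (sym (transpose-fixes
                 (λ πxi≡πxl → yi≢yl (proj₁ coincideₗ (Perm-injective πxi≡πxl)))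
                 (λ πxi≡yl → yi≢yl (trans (eq i i<l) πxi≡yl))))
          (inj₂ refl) → sym (transpose-left (π ⟨$⟩ʳ x l) (y l))
  where
  Perm-injective : ∀ {i j} → π ⟨$⟩ʳ i ≡ π ⟨$⟩ʳ j → i ≡ j
  Perm-injective e = trans (sym (Perm.inverseˡ π)) (trans (cong (π ⟨$⟩ˡ_) e) (Perm.inverseˡ π))

-- Total thanks to the default `d`, so that words become functions on positions and shifts become
-- compositions.
at : ∀ {A : Set} → A → List A → ℕ → A
at d []       _       = d
at d (x ∷ xs) zero    = x
at d (x ∷ xs) (suc i) = at d xs i

module _ {A : Set} {d : A} where

  at-++ˡ : ∀ xs {ys i} → i < length xs → at d (xs ++ ys) i ≡ at d xs i
  at-++ˡ (x ∷ xs) {i = zero}  _         = refl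
  at-++ˡ (x ∷ xs) {i = suc i} (s≤s i<) = at-++ˡ xs i<

  at-++ʳ : ∀ xs {ys} i → at d (xs ++ ys) (length xs + i) ≡ at d ys i
  at-++ʳ []       i = refl
  at-++ʳ (x ∷ xs) i = at-++ʳ xs i

  at-map : ∀ (h : A → A) xs {i} → i < length xs → at d (map h xs) i ≡ h (at d xs i)
  at-map h (x ∷ xs) {zero}  _        = refl
  at-map h (x ∷ xs) {suc i} (s≤s i<) = at-map h xs i<

  at-injective : ∀ {xs ys} → length xs ≡ length ys → (∀ i → i < length xs → at d ys i ≡ at d xs i) → xs ≡ ys
  at-injective {[]}     {[]}     _  _  = refl
  at-injective {x ∷ xs} {y ∷ ys} len eq =
    cong₂ _∷_ (sym (eq 0 (s≤s z≤n))) (at-injective (suc-injective len) (λ i i< → eq (suc i) (s≤s i<)))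

  at-All : ∀ {P : A → Set} {xs} → P d → All P xs → ∀ i → P (at d xs i)
  at-All pd []         i       = pd
  at-All pd (px ∷ pxs) zero    = px
  at-All pd (px ∷ pxs) (suc i) = at-All pd pxs i

  at-All-< : ∀ {P : A → Set} {xs} → All P xs → ∀ i → i < length xs → P (at d xs i)
  at-All-< (px ∷ pxs) zero    _        = px
  at-All-< (px ∷ pxs) (suc i) (s≤s i<) = at-All-< pxs i i<

  at-AllPairs : ∀ {R : A → A → Set} {xs} → AllPairs R xs →
    ∀ i → suc i < length xs → R (at d xs i) (at d xs (suc i))
  at-AllPairs (rx ∷ rxs) zero    (s≤s i<) = at-All-< rx 0 i<
  at-AllPairs (rx ∷ rxs) (suc i) (s≤s i<) = at-AllPairs rxs i i<

-- Bounding the squares counted at one position.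

LastPrefixSquare : ∀ {K} → (ℕ → Fin K) → ℕ → ℕ → Set
LastPrefixSquare z n m = 0 < m × m + m ≤ n × z ∼[ m ] (z ∘ (m +_)) ×
  (∀ a → 0 < a → a + (m + m) ≤ n → ¬ z ∼[ m + m ] (z ∘ (a +_)))

-- More than `K` half-lengths would form a `PrefixSquares`, whose shortest square recurs although it
-- was at its last occurrence.
ascending-bound : ∀ {K} {z : ℕ → Fin K} {n} ms → All (LastPrefixSquare z n) ms → AllPairs _<_ ms → length ms ≤ K
ascending-bound []            _              _   = z≤n
ascending-bound {K} {z} {n} ms@(m₀ ∷ ms′) sqs@(sq₀ ∷ _) asc with K <? length ms
... | no  K≮ = ≮⇒≥ K≮
... | yes K< =
  let _ , _ , _ , last = sqAt 0
      a , p , 0<a , fits , p-inj , reoccurs = first-reoccurs S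
      _ , mK≤n , _ = sqAt K
  in contradiction
       (∼-injective p-inj λ i i< → trans (cong z (+-comm a i)) (reoccurs i i<))
       (last a 0<a (≤-trans fits mK≤n))
  where
  -- The default `m₀` is itself in the list, so the property holds at every index.
  sqAt : ∀ j → LastPrefixSquare z n (at m₀ ms j)
  sqAt = at-All {P = LastPrefixSquare z n} sq₀ sqs
  π : ∀ j → ∃ λ (π : Permutation′ K) → ∀ i → i < at m₀ ms j → z (at m₀ ms j + i) ≡ π ⟨$⟩ʳ z i
  π j = ∼⇒permutation _ (proj₁ (proj₂ (proj₂ (sqAt j))))
  S : PrefixSquares z
  S = record
    { m      = at m₀ ms
    ; f      = λ j → proj₁ (π j) ⟨$⟩ʳ_
    ; g      = λ j → proj₁ (π j) ⟨$⟩ˡ_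
    ; fg     = λ j _ → Perm.inverseʳ (proj₁ (π j))
    ; gf     = λ j _ → Perm.inverseˡ (proj₁ (π j))
    ; square = λ j _ → proj₂ (π j)
    ; mono   = λ j j<K → at-AllPairs asc j (<-≤-trans (s≤s j<K) K<)
    ; pos    = proj₁ sq₀
    }

distinct-bound : ∀ {K} {z : ℕ → Fin K} {n} ms → All (LastPrefixSquare z n) ms → AllPairs _≢_ ms → length ms ≤ K
distinct-bound {K} ms sqs distinct = subst (_≤ K) (↭-length (sort-↭ ms))
  (ascending-bound (sort ms) (All-resp-↭ (↭-sym (sort-↭ ms)) sqs)
    (AllPairs.zipWith (λ (a≤b , a≢b) → ≤∧≢⇒< a≤b a≢b)
      ( Sorted⇒AllPairs ≤-totalOrder (sort-↗ ms)
      , PermSetoid.AllPairs-resp-↭ (setoid ℕ) ≢-sym (resp₂ _≢_) (↭⇒↭ₛ (↭-sym (sort-↭ ms))) distinct)))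

AllPairs-map-All : ∀ {A : Set} {P : A → Set} {R S : A → A → Set} →
  (∀ {a b} → P a → P b → R a b → S a b) → ∀ {xs} → All P xs → AllPairs R xs → AllPairs S xs
AllPairs-map-All h []         []         = []
AllPairs-map-All h (px ∷ pxs) (rx ∷ rxs) =
  All.zipWith (λ (pb , rab) → h px pb rab) (pxs , rx) ∷ AllPairs-map-All h pxs rxs

length-filter-¬ : ∀ {A : Set} {P : A → Set} (P? : Decidable P) xs →
  length xs ≡ length (filter P? xs) + length (filter (¬? ∘ P?) xs)
length-filter-¬ P? []       = refl
length-filter-¬ P? (x ∷ xs) with does (P? x)
... | true  = cong suc (length-filter-¬ P? xs)
... | false = trans (cong suc (length-filter-¬ P? xs)) (sym (+-suc _ _))

-- Summing over all positions.

module _ {k} (d : Fin k) where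

  -- Up to equivalence, so that `w` can be sought in a word over another alphabet.
  Occurs : ∀ {K} → (ℕ → Fin K) → ℕ → Str k → Set
  Occurs z n w = ∃ λ i → i + length w ≤ n × at d w ∼[ length w ] (z ∘ (i +_))

  Square : Str k → Set
  Square w = ∃ λ m → 0 < m × length w ≡ m + m × at d w ∼[ m ] (at d w ∘ (m +_))

  Equivalent : Str k → Str k → Set
  Equivalent a b = length a ≡ length b × at d a ∼[ length a ] at d b

  occurs? : ∀ {K} (z : ℕ → Fin K) n → Decidable (Occurs z n)
  occurs? z n w = map′
    (λ (i , _ , occ) → i , occ)
    (λ (i , le , sim) → i , s≤s (≤-trans (m≤m+n i (length w)) le) , le , sim)
    (anyUpTo? (λ i → (i + length w ≤? n) ×-dec ∼-dec (at d w) (z ∘ (i +_)) (length w)) (suc n))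

  -- These words occur only at position 0, so each is equivalent to a prefix of `z` and is
  -- determined up to equivalence by its length. Inequivalent words therefore have distinct
  -- half-lengths.
  prefix-bound : ∀ {K} (z : ℕ → Fin K) n L → All (Occurs z (suc n)) L → All Square L →
    All (¬_ ∘ Occurs (z ∘ suc) n) L → AllPairs (λ a b → ¬ Equivalent a b) L → length L ≤ K
  prefix-bound {K} z n L occ sq ¬late ineq = subst (_≤ K) (length-map half L)
    (distinct-bound (map half L)
      (All.map⁺ (All.map (λ {w} → last-square w) facts))
      (AllPairs.map⁺ (AllPairs-map-All (λ {a} {b} → distinct a b) facts ineq)))
    where
    half : Str k → ℕ
    half w = ⌊ length w /2⌋
    Fact : Str k → Set
    Fact w = (Occurs z (suc n) w × Square w) × ¬ Occurs (z ∘ suc) n w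
    facts : All Fact L
    facts = All.zip (All.zip (occ , sq) , ¬late)
    length≡ : ∀ w → Fact w → length w ≡ half w + half w
    length≡ w ((_ , m , _ , eq , _) , _) =
      trans eq (cong (λ h → h + h) (trans (n≡⌊n+n/2⌋ m) (cong ⌊_/2⌋ (sym eq))))
    is-prefix : ∀ w → Fact w → length w ≤ suc n × at d w ∼[ length w ] z
    is-prefix w (((zero  , le , sim)     , _) , _)     = le , sim
    is-prefix w (((suc i , s≤s le , sim) , _) , ¬late) = contradiction (i , le , sim) ¬late
    last-square : ∀ w → Fact w → LastPrefixSquare z (suc n) (half w)
    last-square w fact@((_ , m , 0<m , eq , sim) , ¬late) =
      subst (LastPrefixSquare z (suc n)) m≡half
        ( 0<m , subst (_≤ suc n) eq le
        , ∼-trans (∼-sym (∼-prefix (subst (m ≤_) (sym eq) (m≤m+n m m)) w∼z))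
            (∼-trans sim (∼-drop m m (≤-reflexive (sym eq)) w∼z))
        , λ { (suc a) _ (s≤s le′) z∼ → ¬late (a , subst (λ l → a + l ≤ n) (sym eq) le′ ,
                ∼-trans w∼z (subst (λ l → z ∼[ l ] (z ∘ (suc a +_))) (sym eq) z∼)) } )
      where
      m≡half : m ≡ half w
      m≡half = trans (n≡⌊n+n/2⌋ m) (cong ⌊_/2⌋ (sym eq))
      le : length w ≤ suc n
      le = proj₁ (is-prefix w fact)
      w∼z : at d w ∼[ length w ] z
      w∼z = proj₂ (is-prefix w fact)
    distinct : ∀ a b → Fact a → Fact b → ¬ Equivalent a b → half a ≢ half b
    distinct a b fa fb ¬eqv halves = ¬eqv (lengths ,
      ∼-trans (proj₂ (is-prefix a fa)) (∼-sym (subst (λ l → at d b ∼[ l ] z) (sym lengths) (proj₂ (is-prefix b fb)))))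
      where
      lengths : length a ≡ length b
      lengths = trans (length≡ a fa) (trans (cong (λ h → h + h) halves) (sym (length≡ b fb)))

  square-length : ∀ {K} (z : ℕ → Fin K) {n} w → Occurs z n w → Square w → 2 ≤ n
  square-length z w (i , le , _) (m , 0<m , eq , _) =
    ≤-trans (+-mono-≤ 0<m 0<m) (≤-trans (≤-reflexive (sym eq)) (≤-trans (m≤n+m _ i) le))

  -- Induction on `n`, removing the first letter: words that still occur are left to the induction
  -- hypothesis, the others number at most `K`. The factor is `n ∸ 1` because no square fits into
  -- one letter.
  squares-bound : ∀ {K} (z : ℕ → Fin K) n L → All (Occurs z n) L → All Square L →
    AllPairs (λ a b → ¬ Equivalent a b) L → length L ≤ K * (n ∸ 1)
  squares-bound z n       []      _         _        _ = z≤n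
  squares-bound z zero    (w ∷ _) (occ ∷ _) (sq ∷ _) _ = contradiction (square-length z w occ sq) λ ()
  squares-bound z (suc zero) (w ∷ _) (occ ∷ _) (sq ∷ _) _ = contradiction (square-length z w occ sq) λ { (s≤s ()) }
  squares-bound {K} z (suc n@(suc n-1)) L@(_ ∷ _) occ sq ineq = begin
    length L
      ≡⟨ length-filter-¬ late? L ⟩
    length (filter late? L) + length (filter (¬? ∘ late?) L)
      ≤⟨ +-mono-≤
           (squares-bound (z ∘ suc) n (filter late? L) (All.all-filter late? L)
             (All.filter⁺ late? sq) (AllPairs.filter⁺ late? ineq))
           (prefix-bound z n (filter (¬? ∘ late?) L) (All.filter⁺ (¬? ∘ late?) occ)
             (All.filter⁺ (¬? ∘ late?) sq) (All.all-filter (¬? ∘ late?) L)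
             (AllPairs.filter⁺ (¬? ∘ late?) ineq)) ⟩
    K * n-1 + K
      ≡⟨ +-comm (K * n-1) K ⟩
    K + K * n-1
      ≡⟨ *-suc K n-1 ⟨
    K * n
      ∎
    where
    open ≤-Reasoning
    late? : Decidable (Occurs (z ∘ suc) n)
    late? = occurs? (z ∘ suc) n

  Equivalent⇒≈ₚ : ∀ {a b : Str k} → Equivalent a b → a ≈ₚ b
  Equivalent⇒≈ₚ {a} {b} (len , sim) with ∼⇒permutation (length a) sim
  ... | π , eq = Inverse⇒Bijection π , at-injective {d = d} (trans (length-map _ a) len)
    λ i i< → let i<a = subst (i <_) (length-map _ a) i< in
      trans (eq i i<a) (sym (at-map (π ⟨$⟩ʳ_) a i<a))

  IsPSquare⇒Square : ∀ {w} → IsPSquare w → Square w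
  IsPSquare⇒Square (x , .(map (Bijection.to h) x) , x≢[] , refl , h , refl) =
    length x , 0<length x x≢[] ,
    trans (length-++ x) (cong (length x +_) (length-map (Bijection.to h) x)) ,
    ∼-injective (Bijection.injective h) λ i i< → trans (at-++ʳ x i)
      (trans (at-map (Bijection.to h) x i<) (cong (Bijection.to h) (sym (at-++ˡ x i<))))
    where
    0<length : ∀ (x : Str k) → ¬ x ≡ [] → 0 < length x
    0<length []      x≢[] = contradiction refl x≢[]
    0<length (_ ∷ _) _    = s≤s z≤n

  IsSubstring⇒Occurs : ∀ {K} {z : ℕ → Fin K} {w s} → (∀ l → at d s ∼[ l ] z) →
    IsSubstring w s → Occurs z (length s) w
  IsSubstring⇒Occurs {w = w} s∼z (u , v , refl) = length u ,
    ≤-trans (+-monoʳ-≤ (length u) (m≤m+n (length w) (length v)))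
      (≤-reflexive (sym (trans (length-++ u) (cong (length u +_) (length-++ w))))) ,
    ∼-trans (∼-injective {p = id} id λ t t< → trans (at-++ʳ u t) (at-++ˡ w t<))
      (∼-drop (length u) (length w) ≤-refl (s∼z _))

-- Recoding the string over an alphabet of exactly its own letters.

module _ {k} (c : Fin k) (s : Str k) where

  open DecMembership (F._≟_ {k}) using (_∈?_)

  private
    letters : Str k
    letters = deduplicate F._≟_ (c ∷ s)

    ∈-letters : ∀ {x} → x ∈ c ∷ s → x ∈ letters
    ∈-letters = ∈-deduplicate⁺ F._≟_

  rename : Fin k → Fin (σ (c ∷ s))
  rename x with x ∈? letters
  ... | yes x∈ = Any.index x∈
  -- A default: letters outside the string share the number of `c`.
  ... | no  _  = Any.index (∈-letters (here refl))

  lookup-rename : ∀ {x} → x ∈ c ∷ s → lookup letters (rename x) ≡ x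
  lookup-rename {x} x∈s with x ∈? letters
  ... | yes x∈ = sym (lookup-index x∈)
  ... | no  x∉ = contradiction (∈-letters x∈s) x∉

  at∈ : ∀ i → at c (c ∷ s) i ∈ c ∷ s
  at∈ = at-All {P = _∈ c ∷ s} (here refl) (All.tabulate id)

  rename-∼ : ∀ l → at c (c ∷ s) ∼[ l ] (rename ∘ at c (c ∷ s))
  rename-∼ l .coincide {i} _ {j} _ = cong rename , λ eq →
    trans (sym (lookup-rename (at∈ i))) (trans (cong (lookup letters) eq) (lookup-rename (at∈ j)))

theorem6 : (k : ℕ) (s : Str k) → ¬ s ≡ [] →
    (L : List (Str k)) →
    All (λ w → IsSubstring w s × IsPSquare w) L →
    AllPairs (λ a b → ¬ a ≈ₚ b) L →
    length L < σ s * length s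
theorem6 k []         s≢[] L _   _    = contradiction refl s≢[]
theorem6 k s@(c ∷ s′) _    L sqs ineq = begin-strict
  length L            ≤⟨ squares-bound c (rename c s′ ∘ at c s) (length s) L
                           (All.map (IsSubstring⇒Occurs c (rename-∼ c s′) ∘ proj₁) sqs)
                           (All.map (IsPSquare⇒Square c ∘ proj₂) sqs)
                           (AllPairs.map (_∘ Equivalent⇒≈ₚ c) ineq) ⟩
  -- Strict because `σ s` is positive, as `c` occurs in `s`.
  σ s * length s′     <⟨ *-monoʳ-< (σ s) (n<1+n (length s′)) ⟩
  σ s * length s      ∎
  where open ≤-Reasoning
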